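{- Let $\mathcal T$ be a recursion safe $\textit{DL-Lite}^{\mathcal{HR}}$ TBox. For any two conjunctive queries $q_1,q_2$ such that $q_1\leadsto^g_{\mathcal T}q_2$, we have $cert(q_1,\mathcal T,\mathcal A)\subseteq cert(q_2,\mathcal T,\mathcal A)$ for any $k$-bounded ABox $\mathcal A$.
   Context: **Syntax and semantics.** Let $N_C,N_R,N_I$ be countably infinite sets of concept, role and individual names. A role is a role name $p$ or its inverse $p^-$; $N_R^{\pm}$ is the set of roles. TBoxes are in normal form: a $\textit{DL-Lite}_{\mathcal R}$ TBox is a finite set of axioms of the forms $A\sqsubseteq A'$, $A\sqsubseteq\exists p$, $\exists p\sqsubseteq A$, $p\sqsubseteq s$, $p\sqsubseteq s^-$, $\mathbf{disj}(A,A')$, $\mathbf{disj}(p,p')$ with $A,A'\in N_C$, $p,p',s\in N_R$. An ABox is a finite set of assertions $A(a)$, $p(a,b)$ with $a,b\in N_I$ ($p^-(a,b)\in\mathcal A$ means $p(b,a)\in\mathcal A$); $ind(\mathcal A)$ is the set of individuals in $\mathcal A$. A knowledge base (KB) is a pair $(\mathcal T,\mathcal A)$. Interpretations $\mathcal I=(\Delta^{\mathcal I},\cdot^{\mathcal I})$ have $A^{\mathcal I}\subseteq\Delta^{\mathcal I}$, $p^{\mathcal I}\subseteq\Delta^{\mathcal I}\times\Delta^{\mathcal I}$, $(p^-)^{\mathcal I}$ the converse of $p^{\mathcal I}$, $(\exists r)^{\mathcal I}=\{d\mid\exists d'.(d,d')\in r^{\mathcal I}\}$, and $a^{\mathcal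 I}=a$ for individuals (standard names). $\mathcal I$ satisfies $\alpha\sqsubseteq\beta$ iff $\alpha^{\mathcal I}\subseteq\beta^{\mathcal I}$, and $\mathbf{disj}(\alpha,\beta)$ iff $\alpha^{\mathcal I}\cap\beta^{\mathcal I}=\emptyset$; assertions as usual. A model of a KB satisfies all its axioms and assertions. **$\textit{DL-Lite}^{\mathcal{HR}}$.** Fix a set $N_{R_s}\subseteq N_R^{\pm}$ of simple roles closed under inverses; for each $r\in N_R\setminus N_{R_s}$, $r$ and $r^-$ are non-simple. A complex role inclusion (CRI) is $r\cdot s\sqsubseteq t$ with $r,s,t\in N_R$; $\mathcal I$ satisfies it if $(d_1,d_2)\in r^{\mathcal I}$ and $(d_2,d_3)\in s^{\mathcal I}$ imply $(d_1,d_3)\in t^{\mathcal I}$. A $\textit{DL-Lite}^{\mathcal{HR}}$ TBox is a $\textit{DL-Lite}_{\mathcal R}$ TBox that may also contain CRIs, such that for every CRI $r\cdot s\sqsubseteq t$ in it $s$ is simple and $t$ is non-simple, and whenever $s\sqsubseteq t\in\mathcal T$ with $t\in N_{R_s}$ then $s\in N_{R_s}$. **Recursion safety.** The recursion graph of $\mathcal T$ has a node $v_A$ (resp. $v_r$) for each concept name $A$ (resp. role name $r$) in $\mathcal T$, and edges: $v_{A_2}\to v_{A_1}$ for $A_1\sqsubseteq A_2\in\mathcal T$; $v_r\to v_t$ for $t\sqsubseteq r\in\mathcal T$; $v_p\to v_r$ for $r\sqsubseteq p^-\in\mathcal T$; $v_r\to v_A$ for $A\sqsubseteq\exists r\in\mathcal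 T$; $v_A\to v_r$ for $\exists r\sqsubseteq A\in\mathcal T$; $v_t\to v_r$ and $v_t\to v_s$ for $r\cdot s\sqsubseteq t\in\mathcal T$. A role name is recursive in $\mathcal T$ if its node participates in a cycle. Let $\sqsubseteq^{\mathsf s}_{\mathcal T}$ be the reflexive and transitive closure of $\{(s_1,s_2)\mid s_1\sqsubseteq s_2\in\mathcal T,\ s_2\in N_{R_s}\}$. $\mathcal T$ is recursion safe if every CRI $r_1\cdot s\sqsubseteq r_2\in\mathcal T$ satisfies: (i) if $v_{r_2}$ participates in some cycle of the recursion graph, then the cycle has length at most one and $r_1=r_2$; (ii) there is no axiom $A\sqsubseteq\exists t\in\mathcal T$ with $t\sqsubseteq^{\mathsf s}_{\mathcal T}s$ or $t\sqsubseteq^{\mathsf s}_{\mathcal T}s^-$. **$k$-bounded ABoxes.** For a set $S$ of simple roles and $a,b\in ind(\mathcal A)$, an $S$-path of length $n$ between $a$ and $b$ (in $\mathcal A$ w.r.t. $\mathcal T$) exists if there are pairwise distinct $d_1,\dots,d_{n-1}\in ind(\mathcal A)\setminus\{a,b\}$ and $s_1(a,d_1),\dots,s_i(d_{i-1},d_i),\dots,s_n(d_{n-1},b)\in\mathcal A$ such that for each $1\le i\le n$, $s_i\sqsubseteq^{\mathsf s}_{\mathcal T}s$ for some $s\in S$. Let $S_r=\{s\mid r\cdot s\sqsubseteq r\in\mathcal T\}$. $\mathcal A$ is $k$-bounded for $\mathcal T$ if for each recursive $r$ in $\mathcal T$ there is no $S_r$-path of length larger than $k$. **Queries.** A CQ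 is $q(\vec x)=\exists\vec y.\varphi(\vec x,\vec y)$ with $\varphi$ a conjunction of atoms $A(x)$, $r(x,y)$ ($A\in N_C$, $r\in N_R$) and $t=t'$ ($t,t'$ variables or individuals); it is identified with its set of atoms; $\vec x$ are the answer variables. $cert(q,\mathcal T,\mathcal A)$ is the set of tuples $\vec a$ over $ind(\mathcal A)$ with $\mathcal I\models q(\vec a)$ for all models $\mathcal I$ of $(\mathcal T,\mathcal A)$. **Query relaxation.** For a CQ $q$, $z^q$ is a fixed variable not occurring in $q$. Write $q\leadsto^g_{\mathcal T}q'$ if $q'$ results from $q$ by one of the following (replacing the indicated atom(s) of $q$): (G1) $A_1\sqsubseteq A_2\in\mathcal T$: replace $A_1(x)$ by $A_2(x)$; (G2) $A\sqsubseteq\exists r\in\mathcal T$: replace $A(x)$ by $r(x,z^q)$; (G3) $\exists r\sqsubseteq A\in\mathcal T$ and $y$ a non-answer variable occurring only once in $q$: replace $r(x,y)$ by $A(x)$; (G4) $r\sqsubseteq s\in\mathcal T$: replace $r(x,y)$ by $s(x,y)$; (G5) $r\sqsubseteq s^-\in\mathcal T$: replace $r(x,y)$ by $s(y,x)$; (G6) $r\cdot s\sqsubseteq r\in\mathcal T$, $r(x,y),s(y,z)\in q$ and $y$ a non-answer variable not occurring elsewhere in $q$: replace $r(x,y),s(y,z)$ by $r(x,z)$; (G7) $A(x)\in q$ with $x$ a non-answer variable: remove $A(x)$. -}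

module Defs where

open import Data.List.Base using (List; []; _∷_; _++_; [_]; length)
open import Data.List.Membership.Propositional using (_∈_; _∉_)
import Data.List.Relation.Binary.Subset.Propositional as List
open import Data.List.Relation.Unary.All using (All)
open import Data.List.Relation.Unary.Linked using (Linked)
open import Data.List.Relation.Unary.Unique.Propositional using (Unique)
open import Data.Nat.Base using (ℕ; suc; _≤_; _>_)
open import Data.Product.Base using (Σ; ∃-syntax; _×_; _,_)
open import Data.Sum.Base using (_⊎_)
open import Data.Vec.Base as Vec using (Vec)
import Data.Vec.Membership.Propositional as Vec
import Data.Vec.Relation.Unary.All as VecAll
open import Function.Base using (flip)
open import Function.Bundles using (_⇔_; _↔_)
open import Function.Definitions using (Injective)
open import Level using (0ℓ) renaming (suc to lsuc)
open import Relation.Binary.Construct.Closure.ReflexiveTransitive using (Star)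
open import Relation.Binary.Core using (Rel; _⇒_)
open import Relation.Binary.PropositionalEquality using (_≡_; _≢_)
open import Relation.Nullary.Negation using (¬_)
open import Relation.Unary using (Pred; _⊆_; _∩_; Empty)

data Role (NR : Set) : Set where
  name : NR → Role NR
  inv  : NR → Role NR

_⁻ : ∀ {NR} → Role NR → Role NR
name p ⁻ = inv p
inv p  ⁻ = name p

record Signature : Set₁ where
  field
    NC NR NI NV   : Set
    NC-countable  : NC ↔ ℕ
    NR-countable  : NR ↔ ℕ
    NI-countable  : NI ↔ ℕ
    NV-countable  : NV ↔ ℕ
    Simple        : Pred (Role NR) 0ℓ
    Simple-closed : ∀ {R} → Simple R → Simple (R ⁻)

module DL (S : Signature) where
  open Signature S

  infix 5 _⊑ᶜ_ _⊑∃_ ∃ᴿ_⊑_ _⊑ʳ_ _·_⊑_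

  data Axiom : Set where
    _⊑ᶜ_  : NC → NC → Axiom
    _⊑∃_  : NC → NR → Axiom
    ∃ᴿ_⊑_ : NR → NC → Axiom
    -- p ⊑ name s and p ⊑ inv s are the two forms of role inclusions
    _⊑ʳ_  : NR → Role NR → Axiom
    disjᶜ : NC → NC → Axiom
    disjʳ : NR → NR → Axiom
    _·_⊑_ : NR → NR → NR → Axiom

  TBox : Set
  TBox = List Axiom

  record IsDLLiteHR (T : TBox) : Set where
    field
      cri-simple     : ∀ {r s t} → (r · s ⊑ t) ∈ T → Simple (name s)
      cri-non-simple : ∀ {r s t} → (r · s ⊑ t) ∈ T → ¬ Simple (name t)
      ri-simple      : ∀ {s R} → (s ⊑ʳ R) ∈ T → Simple R → Simple (name s)

  data Assertion : Set where
    conceptA : NC → NI → Assertion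
    roleA    : NR → NI → NI → Assertion

  ABox : Set
  ABox = List Assertion

  data Mentions (a : NI) : Assertion → Set where
    inConcept : ∀ {A} → Mentions a (conceptA A a)
    inFirst   : ∀ {p b} → Mentions a (roleA p a b)
    inSecond  : ∀ {p b} → Mentions a (roleA p b a)

  individuals : ABox → Pred NI 0ℓ
  individuals 𝒜 a = ∃[ α ] (α ∈ 𝒜 × Mentions a α)

  assertion : Role NR → NI → NI → Assertion
  assertion (name p) a b = roleA p a b
  assertion (inv p)  a b = roleA p b a

  -- The standard name assumption (individuals belong to the domain and denote
  -- themselves) is an embedding of NI into the domain.
  record Interpretation : Set₁ where
    field
      Δ             : Set
      ind           : NI → Δ
      ind-injective : Injective _≡_ _≡_ ind
      conceptI      : NC → Pred Δ 0ℓ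
      roleNameI     : NR → Rel Δ 0ℓ

    roleI : Role NR → Rel Δ 0ℓ
    roleI (name p) = roleNameI p
    roleI (inv p)  = flip (roleNameI p)

    existsI : Role NR → Pred Δ 0ℓ
    existsI R d = ∃[ d′ ] roleI R d d′

  module _ (I : Interpretation) where
    open Interpretation I

    SatisfiesAxiom : Axiom → Set
    SatisfiesAxiom (A ⊑ᶜ A′)    = conceptI A ⊆ conceptI A′
    SatisfiesAxiom (A ⊑∃ p)     = conceptI A ⊆ existsI (name p)
    SatisfiesAxiom (∃ᴿ p ⊑ A)   = existsI (name p) ⊆ conceptI A
    SatisfiesAxiom (p ⊑ʳ R)     = roleI (name p) ⇒ roleI R
    SatisfiesAxiom (disjᶜ A A′) = Empty (conceptI A ∩ conceptI A′)
    SatisfiesAxiom (disjʳ p p′) = ∀ d → Empty (roleNameI p d ∩ roleNameI p′ d)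
    SatisfiesAxiom (r · s ⊑ t)  =
      ∀ {d₁ d₂ d₃} → roleNameI r d₁ d₂ → roleNameI s d₂ d₃ → roleNameI t d₁ d₃

    SatisfiesAssertion : Assertion → Set
    SatisfiesAssertion (conceptA A a) = conceptI A (ind a)
    SatisfiesAssertion (roleA p a b)  = roleNameI p (ind a) (ind b)

    record IsModel (T : TBox) (𝒜 : ABox) : Set where
      field
        satisfies-T : All SatisfiesAxiom T
        satisfies-𝒜 : All SatisfiesAssertion 𝒜

  data Node : Set where
    vᶜ : NC → Node
    vʳ : NR → Node

  -- Names not occurring in T are isolated nodes, hence on no cycle.
  data Edge (T : TBox) : Rel Node 0ℓ where
    concept-incl : ∀ {A₁ A₂} → (A₁ ⊑ᶜ A₂) ∈ T → Edge T (vᶜ A₂) (vᶜ A₁)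
    role-incl    : ∀ {t r} → (t ⊑ʳ name r) ∈ T → Edge T (vʳ r) (vʳ t)
    inv-incl     : ∀ {r p} → (r ⊑ʳ inv p) ∈ T → Edge T (vʳ p) (vʳ r)
    exists-right : ∀ {A r} → (A ⊑∃ r) ∈ T → Edge T (vʳ r) (vᶜ A)
    exists-left  : ∀ {r A} → (∃ᴿ r ⊑ A) ∈ T → Edge T (vᶜ A) (vʳ r)
    cri-first    : ∀ {r s t} → (r · s ⊑ t) ∈ T → Edge T (vʳ t) (vʳ r)
    cri-second   : ∀ {r s t} → (r · s ⊑ t) ∈ T → Edge T (vʳ t) (vʳ s)

  -- Cycles are simple: with arbitrary closed walks, going twice round a
  -- self-loop would be a cycle of length two.  The closing node is not
  -- repeated in `nodes`.
  record Cycle (T : TBox) : Set where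
    field
      start    : Node
      rest     : List Node
      distinct : Unique (start ∷ rest)
      closed   : Linked (Edge T) (start ∷ rest ++ [ start ])

    nodes : List Node
    nodes = start ∷ rest

    cycleLength : ℕ
    cycleLength = length nodes

  open Cycle using (nodes; cycleLength)

  Recursive : TBox → Pred NR 0ℓ
  Recursive T r = Σ (Cycle T) λ c → vʳ r ∈ nodes c

  data SimpleInclusion (T : TBox) : Rel (Role NR) 0ℓ where
    simple-incl : ∀ {s₁ R₂} → (s₁ ⊑ʳ R₂) ∈ T → Simple R₂ →
                  SimpleInclusion T (name s₁) R₂

  _⊢_⊑ˢ_ : TBox → Rel (Role NR) 0ℓ
  T ⊢ R₁ ⊑ˢ R₂ = Star (SimpleInclusion T) R₁ R₂

  record RecursionSafe (T : TBox) : Set where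
    field
      cycles : ∀ {r₁ s r₂} → (r₁ · s ⊑ r₂) ∈ T →
               (c : Cycle T) → vʳ r₂ ∈ nodes c → cycleLength c ≤ 1 × r₁ ≡ r₂
      no-existential : ∀ {r₁ s r₂} → (r₁ · s ⊑ r₂) ∈ T →
               ¬ (∃[ A ] ∃[ t ] ((A ⊑∃ t) ∈ T ×
                    (T ⊢ name t ⊑ˢ name s ⊎ T ⊢ name t ⊑ˢ inv s)))

  PathStep : TBox → ABox → Pred (Role NR) 0ℓ → Rel NI 0ℓ
  PathStep T 𝒜 P d d′ =
    ∃[ R ] (assertion R d d′ ∈ 𝒜 × ∃[ s ] (P s × T ⊢ R ⊑ˢ s))

  record Path (T : TBox) (𝒜 : ABox) (P : Pred (Role NR) 0ℓ)
              (a b : NI) (n : ℕ) : Set where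
    field
      inner             : List NI
      length-inner      : suc (length inner) ≡ n
      inner-distinct    : Unique inner
      inner-individuals : All (individuals 𝒜) inner
      inner-≢-start     : All (_≢ a) inner
      inner-≢-end       : All (_≢ b) inner
      steps             : Linked (PathStep T 𝒜 P) (a ∷ inner ++ [ b ])

  recursionRoles : TBox → NR → Pred (Role NR) 0ℓ
  recursionRoles T r R = ∃[ s ] (R ≡ name s × (r · s ⊑ r) ∈ T)

  Bounded : ℕ → TBox → ABox → Set
  Bounded k T 𝒜 = ∀ r → Recursive T r →
    ∀ a b n → n > k → ¬ Path T 𝒜 (recursionRoles T r) a b n

  data Term : Set where
    var : NV → Term
    ind : NI → Term

  data Atom : Set where
    conceptQ : NC → NV → Atom
    roleQ    : NR → NV → NV → Atom
    _≐_      : Term → Term → Atom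

  -- `atoms` is read as a set; the existentially quantified variables are those
  -- not in `answer`.
  record CQ (n : ℕ) : Set where
    constructor ⟨_∣_⟩
    field
      answer : Vec NV n
      atoms  : List Atom

  open CQ

  data Position (y : NV) : Atom → Set where
    arg  : ∀ {A} → Position y (conceptQ A y)
    arg₁ : ∀ {r x} → Position y (roleQ r y x)
    arg₂ : ∀ {r x} → Position y (roleQ r x y)
    lhs  : ∀ {t} → Position y (var y ≐ t)
    rhs  : ∀ {t} → Position y (t ≐ var y)

  Occurrence : NV → Set
  Occurrence y = Σ Atom (Position y)

  OccursIn : ∀ {n} → NV → CQ n → Set
  OccursIn y q = y Vec.∈ answer q ⊎ ∃[ α ] (α ∈ atoms q × Position y α)

  -- The list enumerates the only occurrences of y among the atoms.
  OccursOnlyAt : ∀ {n} (y : NV) → CQ n → List (Occurrence y) → Set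
  OccursOnlyAt y q occs = ∀ α → α ∈ atoms q → (i : Position y α) → (α , i) ∈ occs

  NonAnswer : ∀ {n} → NV → CQ n → Set
  NonAnswer y q = y Vec.∉ answer q

  module _ (I : Interpretation) where
    open Interpretation I renaming (ind to indI)

    value : (NV → Δ) → Term → Δ
    value π (var x) = π x
    value π (ind a) = indI a

    SatisfiesAtom : (NV → Δ) → Atom → Set
    SatisfiesAtom π (conceptQ A x) = conceptI A (π x)
    SatisfiesAtom π (roleQ r x y)  = roleNameI r (π x) (π y)
    SatisfiesAtom π (t ≐ t′)       = value π t ≡ value π t′

    SatisfiesQuery : ∀ {n} → CQ n → Vec NI n → Set
    SatisfiesQuery q as =
      ∃[ π ] (Vec.map π (answer q) ≡ Vec.map indI as × All (SatisfiesAtom π) (atoms q))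

  cert : ∀ {n} → CQ n → TBox → ABox → Pred (Vec NI n) (lsuc 0ℓ)
  cert q T 𝒜 as = VecAll.All (individuals 𝒜) as ×
    (∀ I → IsModel I T 𝒜 → SatisfiesQuery I q as)

  record FreshVariable : Set where
    field
      z       : ∀ {n} → CQ n → NV
      z-fresh : ∀ {n} (q : CQ n) → ¬ OccursIn (z q) q

  -- q′ is (q ∖ old) ∪ new as a set of atoms, where old ⊆ q.
  record Replace {n} (q : CQ n) (old new : List Atom) (q′ : CQ n) : Set where
    field
      same-answer : answer q′ ≡ answer q
      old-present : old List.⊆ atoms q
      new-atoms   : ∀ α → α ∈ atoms q′ ⇔ ((α ∈ atoms q × α ∉ old) ⊎ α ∈ new)

  module _ (F : FreshVariable) (T : TBox) where
    open FreshVariable F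

    data Relaxes {n} (q q′ : CQ n) : Set where
      G1 : ∀ {A₁ A₂ x} → (A₁ ⊑ᶜ A₂) ∈ T →
           Replace q [ conceptQ A₁ x ] [ conceptQ A₂ x ] q′ → Relaxes q q′
      G2 : ∀ {A r x} → (A ⊑∃ r) ∈ T →
           Replace q [ conceptQ A x ] [ roleQ r x (z q) ] q′ → Relaxes q q′
      G3 : ∀ {r A x y} → (∃ᴿ r ⊑ A) ∈ T →
           NonAnswer y q → OccursOnlyAt y q [ roleQ r x y , arg₂ ] →
           Replace q [ roleQ r x y ] [ conceptQ A x ] q′ → Relaxes q q′
      G4 : ∀ {r s x y} → (r ⊑ʳ name s) ∈ T →
           Replace q [ roleQ r x y ] [ roleQ s x y ] q′ → Relaxes q q′
      G5 : ∀ {r s x y} → (r ⊑ʳ inv s) ∈ T →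
           Replace q [ roleQ r x y ] [ roleQ s y x ] q′ → Relaxes q q′
      G6 : ∀ {r s x y v} → (r · s ⊑ r) ∈ T →
           NonAnswer y q →
           OccursOnlyAt y q ((roleQ r x y , arg₂) ∷ (roleQ s y v , arg₁) ∷ []) →
           Replace q (roleQ r x y ∷ roleQ s y v ∷ []) [ roleQ r x v ] q′ → Relaxes q q′
      G7 : ∀ {A x} → NonAnswer x q →
           Replace q [ conceptQ A x ] [] q′ → Relaxes q q′

{-# OPTIONS --safe #-}

-- Every rule keeps a match of q₁ in a model a match of q₂: the axiom licensing
-- the rule turns the removed atoms into the added ones.  Only G2 changes the
-- match, sending the fresh variable to the witness of the existential.

module Submission where

open import Defs
open import Data.List.Base using ([]; _∷_)
open import Data.List.Membership.Propositional using (_∈_)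
open import Data.List.Relation.Unary.All as All using (All; []; _∷_)
open import Data.List.Relation.Unary.Any using (here)
open import Data.Nat.Base using (ℕ)
import Data.Nat.Properties as ℕ
open import Data.Product.Base using (_×_; _,_)
open import Data.Sum.Base using (inj₁; inj₂)
open import Data.Vec.Base as Vec using (Vec; []; _∷_)
import Data.Vec.Membership.Propositional as Vec
import Data.Vec.Relation.Unary.Any as VecAny
open import Function.Base using (_∘_)
open import Function.Bundles using (Equivalence)
open import Function.Properties.Inverse using (↔⇒↣)
open import Relation.Binary.Definitions using (DecidableEquality)
open import Relation.Binary.PropositionalEquality
  using (_≡_; _≢_; refl; sym; trans; cong; cong₂; subst; subst₂)
open import Relation.Nullary.Decidable using (yes; no; via-injection)
open import Relation.Nullary.Negation using (contradiction)
open import Relation.Unary using (_⊆_)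

-- Agreement is asked only on the entries of `xs`, since the assignments compared later may differ
-- at a variable outside the answer tuple.
map-cong-∈ : ∀ {A B : Set} {f g : A → B} {n} (xs : Vec A n) →
             (∀ {x} → x Vec.∈ xs → f x ≡ g x) → Vec.map f xs ≡ Vec.map g xs
map-cong-∈ []       f≗g = refl
map-cong-∈ (x ∷ xs) f≗g =
  cong₂ _∷_ (f≗g (VecAny.here refl)) (map-cong-∈ xs (f≗g ∘ VecAny.there))

module Update {A B : Set} (_≟_ : DecidableEquality A) where

  _[_≔_] : (A → B) → A → B → A → B
  (f [ a ≔ b ]) x with x ≟ a
  ... | yes _ = b
  ... | no  _ = f x

  update-≡ : ∀ f a b → (f [ a ≔ b ]) a ≡ b
  update-≡ f a b with a ≟ a
  ... | yes _   = refl
  ... | no  a≢a = contradiction refl a≢a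

  update-≢ : ∀ f {a} b {x} → x ≢ a → (f [ a ≔ b ]) x ≡ f x
  update-≢ f {a} b {x} x≢a with x ≟ a
  ... | yes x≡a = contradiction x≡a x≢a
  ... | no  _   = refl

module _ (S : Signature) where
  open Signature S
  open DL S
  open CQ

  _≟ᵛ_ : DecidableEquality NV
  _≟ᵛ_ = via-injection (↔⇒↣ NV-countable) ℕ._≟_

  module _ (I : Interpretation) where
    open Interpretation I renaming (ind to indI)

    -- The body of `SatisfiesQuery` with the assignment exposed, so that a rule can say which
    -- assignment it keeps or changes.
    Match : ∀ {n} → CQ n → Vec NI n → (NV → Δ) → Set
    Match q as π =
      Vec.map π (answer q) ≡ Vec.map indI as × All (SatisfiesAtom I π) (atoms q)

    -- A bare term has no `Position`, so its variable is given by an equation; matching it with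
    -- `refl` inside an equality atom leaves a `lhs` or `rhs` position.
    value-agree : ∀ {π π′} t → (∀ {y} → t ≡ var y → π y ≡ π′ y) →
                  value I π t ≡ value I π′ t
    value-agree (var x) π≗π′ = π≗π′ refl
    value-agree (ind a) π≗π′ = refl

    atom-agree : ∀ {π π′} α → (∀ {y} → Position y α → π y ≡ π′ y) →
                 SatisfiesAtom I π α → SatisfiesAtom I π′ α
    atom-agree (conceptQ A x) π≗π′ = subst (conceptI A) (π≗π′ arg)
    atom-agree (roleQ r x y)  π≗π′ = subst₂ (roleNameI r) (π≗π′ arg₁) (π≗π′ arg₂)
    atom-agree (t ≐ t′)       π≗π′ =
      subst₂ _≡_ (value-agree t  λ { refl → π≗π′ lhs })
                 (value-agree t′ λ { refl → π≗π′ rhs })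

    -- This allows an assignment to be changed at a variable that is fresh for `q`.
    match-agree : ∀ {n} (q : CQ n) {as π π′} → (∀ {y} → OccursIn y q → π y ≡ π′ y) →
                  Match q as π → Match q as π′
    match-agree q π≗π′ (π-answer , π-atoms) =
        trans (sym (map-cong-∈ (answer q) (π≗π′ ∘ inj₁))) π-answer
      , All.tabulate λ {α} α∈q →
          atom-agree α (λ i → π≗π′ (inj₂ (α , α∈q , i))) (All.lookup π-atoms α∈q)

    -- Atoms kept from `q` hold already, and the old ones lie in `q`, so they are available for
    -- deriving the new ones under the same `π`. A rule then only has to supply that derivation.
    replace-match : ∀ {n} {q q′ : CQ n} {old new as π} → Replace q old new q′ →
                    (All (SatisfiesAtom I π) old → All (SatisfiesAtom I π) new) →
                    Match q as π → Match q′ as π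
    replace-match {q′ = q′} {old} {new} {π = π} rep old⇒new (π-answer , π-atoms) =
        trans (cong (Vec.map π) same-answer) π-answer
      , All.tabulate satisfied
      where
      open Replace rep

      π-new : All (SatisfiesAtom I π) new
      π-new = old⇒new (All.tabulate (All.lookup π-atoms ∘ old-present))

      satisfied : ∀ {α} → α ∈ atoms q′ → SatisfiesAtom I π α
      satisfied {α} α∈q′ with Equivalence.to (new-atoms α) α∈q′
      ... | inj₁ (α∈q , _) = All.lookup π-atoms α∈q
      ... | inj₂ α∈new     = All.lookup π-new α∈new

    module _ (F : FreshVariable) {T : TBox} (⊨T : All (SatisfiesAxiom I) T) where
      open FreshVariable F
      open Update {B = Δ} _≟ᵛ_

      relax-match : ∀ {n} {q q′ : CQ n} {as} → Relaxes F T q q′ →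
                    SatisfiesQuery I q as → SatisfiesQuery I q′ as
      relax-match (G1 ax rep) (π , m) =
        π , replace-match rep (λ { (a ∷ []) → All.lookup ⊨T ax a ∷ [] }) m
      relax-match {q = q} (G2 {r = r} {x = x} ax rep) (π , m@(_ , π-atoms))
        with All.lookup ⊨T ax (All.lookup π-atoms (Replace.old-present rep (here refl)))
      ... | d , rxd =
        -- The match is first moved to `π′`; the new atom then comes from `rxd`, obtained from the
        -- old atom under `π`.
        π′ , replace-match rep (λ _ → π′-new ∷ []) (match-agree q (sym ∘ π′≗π) m)
        where
        π′ : NV → Δ
        π′ = π [ z q ≔ d ]

        π′≗π : ∀ {y} → OccursIn y q → π′ y ≡ π y
        π′≗π y∈q = update-≢ π d λ { refl → z-fresh q y∈q }

        x∈q : OccursIn x q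
        x∈q = inj₂ (_ , Replace.old-present rep (here refl) , arg)

        π′-new : roleNameI r (π′ x) (π′ (z q))
        -- `x` occurs in the removed atom, so it keeps its value, while `z q` now denotes the
        -- witness `d`.
        π′-new = subst₂ (roleNameI r) (sym (π′≗π x∈q)) (sym (update-≡ π (z q) d)) rxd
      -- The witness left implicit is the value of `y`.
      relax-match (G3 ax _ _ rep) (π , m) =
        π , replace-match rep (λ { (r ∷ []) → All.lookup ⊨T ax (_ , r) ∷ [] }) m
      relax-match (G4 ax rep) (π , m) =
        π , replace-match rep (λ { (r ∷ []) → All.lookup ⊨T ax r ∷ [] }) m
      -- The swap of arguments is by computation: `roleI` of an inverse is the flipped relation.
      relax-match (G5 ax rep) (π , m) =
        π , replace-match rep (λ { (r ∷ []) → All.lookup ⊨T ax r ∷ [] }) m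
      -- The value of `y` is the midpoint at which the two role edges compose.
      relax-match (G6 ax _ _ rep) (π , m) =
        π , replace-match rep (λ { (r ∷ s ∷ []) → All.lookup ⊨T ax r s ∷ [] }) m
      relax-match (G7 _ rep) (π , m) =
        π , replace-match rep (λ _ → []) m

proposition3 : (S : Signature) → let open DL S in
    (F : FreshVariable) (T : TBox) → IsDLLiteHR T → RecursionSafe T →
    ∀ {n} (q₁ q₂ : CQ n) → Relaxes F T q₁ q₂ →
    ∀ (k : ℕ) (𝒜 : ABox) → Bounded k T 𝒜 →
    cert q₁ T 𝒜 ⊆ cert q₂ T 𝒜
proposition3 S F T _ _ q₁ q₂ q₁↝q₂ k 𝒜 _ (as-individuals , q₁-certain) =
    as-individuals
  -- Each model is treated separately, starting from the match of `q₁` that certainty provides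
  -- there.
  , λ I I⊨ → relax-match S I F (DL.IsModel.satisfies-T I⊨) q₁↝q₂ (q₁-certain I I⊨)
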